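{- For any odd integer $n\geq 1$ we have $$\sum_{j=1}^n(-1)^{j+1}\left\lfloor\sqrt{jn}\right\rfloor=\frac{n+1}{2}.$$
   Context: For $x\in\mathbb{R}$, $\lfloor x\rfloor$ denotes the floor function, i.e. the integer defined by $\lfloor x\rfloor\leq x<\lfloor x\rfloor+1$. -}

module Defs where

open import Data.Empty using (⊥)
open import Data.Integer as ℤ using (ℤ; +_)
import Data.Integer.Properties as ℤ
open import Data.Nat as ℕ using (ℕ; zero; suc)
import Data.Nat.Properties as ℕ
open import Data.Product using (Σ; ∃; ∃-syntax; _×_; _,_; proj₁; proj₂)
open import Data.Rational using (ℚ; 0ℚ; 1ℚ; _+_; _-_; -_; _*_; _<_; _≤_; 1/_; _/_; toℚᵘ; Positive; positive; NonNegative; nonNegative)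
open import Data.Rational.Properties
open import Data.Rational.Solver using (module +-*-Solver)
import Data.Rational.Unnormalised as ℚᵘ
import Data.Rational.Unnormalised.Properties as ℚᵘ
open import Data.Sum using (_⊎_; inj₁; inj₂)
open import Relation.Binary.PropositionalEquality using (_≡_; refl; sym; trans; cong; cong₂; subst; subst₂)
open import Relation.Nullary using (¬_; yes; no; contradiction)

-- Real numbers as two-sided (located) Dedekind cuts of ℚ:
-- L q means q < x, and U q means x < q.

record ℝ : Set₁ where
  field
    L U       : ℚ → Set
    L-inhab   : ∃ L
    U-inhab   : ∃ U
    L-down    : ∀ {q r} → q < r → L r → L q
    U-up      : ∀ {q r} → q < r → U q → U r
    L-open    : ∀ {q} → L q → ∃[ r ] q < r × L r
    U-open    : ∀ {r} → U r → ∃[ q ] q < r × U q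
    disjoint  : ∀ {q} → L q → U q → ⊥
    located   : ∀ {q r} → q < r → L q ⊎ U r

open ℝ

infix 4 _≤ᴿ_ _<ᴿ_

_≤ᴿ_ : ℝ → ℝ → Set
x ≤ᴿ y = ∀ {q} → L x q → L y q

_<ᴿ_ : ℝ → ℝ → Set
x <ᴿ y = ∃[ q ] U x q × L y q

private
  q-1<q : ∀ q → q - 1ℚ < q
  q-1<q q = subst (q - 1ℚ <_) (+-identityʳ q) (+-monoʳ-< q (negative⁻¹ (- 1ℚ)))

  q<q+1 : ∀ q → q < q + 1ℚ
  q<q+1 q = subst (_< q + 1ℚ) (+-identityʳ q) (+-monoʳ-< q (positive⁻¹ 1ℚ))

fromℚ : ℚ → ℝ
fromℚ p = record
  { L = _< p
  ; U = p <_
  ; L-inhab = p - 1ℚ , q-1<q p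
  ; U-inhab = p + 1ℚ , q<q+1 p
  ; L-down = <-trans
  ; U-up = λ q<r p<q → <-trans p<q q<r
  ; L-open = λ q<p → let (m , q<m , m<p) = <-dense q<p in m , q<m , m<p
  ; U-open = λ p<r → let (m , p<m , m<r) = <-dense p<r in m , m<r , p<m
  ; disjoint = <-asym
  ; located = loc
  }
  where
  loc : ∀ {q r} → q < r → q < p ⊎ p < r
  loc {q} q<r with q <? p
  ... | yes q<p = inj₁ q<p
  ... | no  q≮p = inj₂ (≤-<-trans (≮⇒≥ q≮p) q<r)

fromℤ : ℤ → ℝ
fromℤ m = fromℚ (m / 1)

fromℕ : ℕ → ℝ
fromℕ k = fromℤ (+ k)

private
  sq-mono-< : ∀ {q r} → 0ℚ ≤ q → q < r → q * q < r * r
  sq-mono-< {q} {r} 0≤q q<r = ≤-<-trans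
    (*-monoˡ-≤-nonNeg q {{nonNegative 0≤q}} (<⇒≤ q<r))
    (*-monoˡ-<-pos r {{positive (≤-<-trans 0≤q q<r)}} q<r)

  sq-nonNeg : ∀ {q} → 0ℚ ≤ q → 0ℚ ≤ q * q
  sq-nonNeg {q} 0≤q = subst (_≤ q * q) (*-zeroˡ q) (*-monoʳ-≤-nonNeg q {{nonNegative 0≤q}} 0≤q)

  sq-cancel-< : ∀ {q r} → 0ℚ ≤ r → q * q < r * r → q < r
  sq-cancel-< {q} {r} 0≤r qq<rr with q <? r
  ... | yes q<r = q<r
  ... | no  q≮r = contradiction (<-≤-trans qq<rr
          (≤-trans (*-monoʳ-≤-nonNeg r {{nonNegative 0≤r}} r≤q)
                   (*-monoˡ-≤-nonNeg q {{nonNegative (≤-trans 0≤r r≤q)}} r≤q)))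
          (<-irrefl refl)
    where r≤q = ≮⇒≥ q≮r

  diff>0 : ∀ {p q} → p < q → 0ℚ < q - p
  diff>0 {p} {q} p<q = subst (_< q - p) (+-inverseʳ p) (+-monoˡ-< (- p) p<q)

  <-from-diff : ∀ {p q d} → 0ℚ < d → q ≡ p + d → p < q
  <-from-diff {p} {q} {d} 0<d eq =
    subst₂ _<_ (+-identityʳ p) (sym eq) (+-monoʳ-< p 0<d)

  *-pos : ∀ {p q} → 0ℚ < p → 0ℚ < q → 0ℚ < p * q
  *-pos {p} {q} 0<p 0<q = subst (_< p * q) (*-zeroˡ q) (*-monoˡ-<-pos q {{positive 0<q}} 0<p)

  -- r = (q c + s) / (q + c) with c = s + 1 lies strictly between q and √s:
  -- r (q + c) − q (q + c) = s − q²  and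
  -- s (q + c)² − (r (q + c))² = (s − q²)(c² − s).
  module Step (q s : ℚ) (0≤q : 0ℚ ≤ q) (0≤s : 0ℚ ≤ s) where
    c e : ℚ
    c = s + 1ℚ
    e = q + c

    s<c : s < c
    s<c = q<q+1 s

    0<c : 0ℚ < c
    0<c = ≤-<-trans 0≤s s<c

    s<cc : s < c * c
    s<cc = <-≤-trans s<c (subst (_≤ c * c) (*-identityʳ c)
      (*-monoˡ-≤-nonNeg c {{nonNegative (<⇒≤ 0<c)}}
        (subst (_≤ c) (+-identityˡ 1ℚ) (+-monoˡ-≤ 1ℚ 0≤s))))

    0<e : 0ℚ < e
    0<e = subst (_< e) (+-identityˡ 0ℚ) (+-mono-≤-< 0≤q 0<c)

    instance
      e-pos : Positive e
      e-pos = positive 0<e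
      e-nonNeg : NonNegative e
      e-nonNeg = nonNegative (<⇒≤ 0<e)
      ee-nonNeg : NonNegative (e * e)
      ee-nonNeg = nonNegative (<⇒≤ (*-pos 0<e 0<e))

    t r : ℚ
    t = q * c + s
    r = t * (1/ e) {{pos⇒nonZero e}}

    re≡t : r * e ≡ t
    re≡t = trans (*-assoc t _ e)
             (trans (cong (t *_) (*-inverseˡ e {{pos⇒nonZero e}})) (*-identityʳ t))

    open +-*-Solver

    rree≡tt : r * r * (e * e) ≡ t * t
    rree≡tt = trans
      (solve 2 (λ r e → r :* r :* (e :* e) := (r :* e) :* (r :* e)) refl r e)
      (cong₂ _*_ re≡t re≡t)

    up : q * q < s → q < r × r * r < s
    up qq<s =
        *-cancelʳ-<-nonNeg e (subst (q * e <_) (sym re≡t)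
          (<-from-diff (diff>0 qq<s)
            (solve 3 (λ q c s → q :* c :+ s := q :* (q :+ c) :+ (s :- q :* q)) refl q c s)))
      , *-cancelʳ-<-nonNeg (e * e) (subst (_< s * (e * e)) (sym rree≡tt)
          (<-from-diff (*-pos (diff>0 qq<s) (diff>0 s<cc))
            (solve 3 (λ q c s → s :* ((q :+ c) :* (q :+ c))
                := (q :* c :+ s) :* (q :* c :+ s) :+ (s :- q :* q) :* (c :* c :- s))
              refl q c s)))

    down : s < q * q → r < q × s < r * r × 0ℚ ≤ r
    down s<qq =
        *-cancelʳ-<-nonNeg e (subst (_< q * e) (sym re≡t)
          (<-from-diff (diff>0 s<qq)
            (solve 3 (λ q c s → q :* (q :+ c) := (q :* c :+ s) :+ (q :* q :- s)) refl q c s)))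
      , *-cancelʳ-<-nonNeg (e * e) (subst (s * (e * e) <_) (sym rree≡tt)
          (<-from-diff (*-pos (diff>0 s<qq) (diff>0 s<cc))
            (solve 3 (λ q c s → (q :* c :+ s) :* (q :* c :+ s)
                := s :* ((q :+ c) :* (q :+ c)) :+ (q :* q :- s) :* (c :* c :- s))
              refl q c s)))
      , *-cancelʳ-≤-pos e (subst₂ _≤_ (sym (*-zeroˡ e)) (sym re≡t) 0≤t)
      where
      0≤t : 0ℚ ≤ t
      0≤t = subst (_≤ t) (+-identityˡ 0ℚ) (+-mono-≤
        (subst (_≤ q * c) (*-zeroˡ c) (*-monoʳ-≤-nonNeg c {{nonNegative (<⇒≤ 0<c)}} 0≤q)) 0≤s)

-- For x ≥ 0:  q < √x  iff  q < 0 or q² < x,  and  √x < q  iff  0 < q and x < q².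
-- For x < 0 the same cut is 0.

√ : ℝ → ℝ
√ x = record
  { L = Lo
  ; U = Up
  ; L-inhab = - 1ℚ , inj₁ (negative⁻¹ (- 1ℚ))
  ; U-inhab = up-inhab (U-inhab x)
  ; L-down = lo-down
  ; U-up = λ { q<r (0<q , x<qq) → <-trans 0<q q<r , U-up x (sq-mono-< (<⇒≤ 0<q) q<r) x<qq }
  ; L-open = lo-open
  ; U-open = up-open
  ; disjoint = λ { (inj₁ q<0) (0<q , _) → <-asym q<0 0<q
                 ; (inj₂ qq<x) (_ , x<qq) → disjoint x qq<x x<qq }
  ; located = loc
  }
  where
  Lo Up : ℚ → Set
  Lo q = q < 0ℚ ⊎ L x (q * q)
  Up q = 0ℚ < q × U x (q * q)

  up-inhab : ∃ (U x) → ∃ Up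
  up-inhab (u , x<u) with u <? 1ℚ
  ... | yes u<1 = 1ℚ , positive⁻¹ 1ℚ , U-up x u<1 x<u
  ... | no  u≮1 = v , 0<v , U-up x u<vv x<u
    where
    v = u + 1ℚ
    1≤v : 1ℚ ≤ v
    1≤v = ≤-trans (≮⇒≥ u≮1) (<⇒≤ (q<q+1 u))
    0<v : 0ℚ < v
    0<v = <-≤-trans (positive⁻¹ 1ℚ) 1≤v
    u<vv : u < v * v
    u<vv = <-≤-trans (q<q+1 u) (subst (_≤ v * v) (*-identityʳ v)
             (*-monoˡ-≤-nonNeg v {{nonNegative (<⇒≤ 0<v)}} 1≤v))

  lo-down : ∀ {q r} → q < r → Lo r → Lo q
  lo-down q<r (inj₁ r<0) = inj₁ (<-trans q<r r<0)
  lo-down {q} q<r (inj₂ rr<x) with q <? 0ℚ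
  ... | yes q<0 = inj₁ q<0
  ... | no  q≮0 = inj₂ (L-down x (sq-mono-< (≮⇒≥ q≮0) q<r) rr<x)

  lo-open-neg : ∀ {q} → q < 0ℚ → ∃[ r ] q < r × Lo r
  lo-open-neg q<0 = let (r , q<r , r<0) = <-dense q<0 in r , q<r , inj₁ r<0

  lo-open : ∀ {q} → Lo q → ∃[ r ] q < r × Lo r
  lo-open (inj₁ q<0) = lo-open-neg q<0
  lo-open {q} (inj₂ qq<x) with q <? 0ℚ | L-open x qq<x
  ... | yes q<0 | _ = lo-open-neg q<0
  ... | no  q≮0 | s , qq<s , s<x = r , proj₁ (up qq<s) , inj₂ (L-down x (proj₂ (up qq<s)) s<x)
    where
    0≤q = ≮⇒≥ q≮0
    open Step q s 0≤q (≤-trans (sq-nonNeg 0≤q) (<⇒≤ qq<s)) using (r; up)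

  up-open : ∀ {r} → Up r → ∃[ q ] q < r × Up q
  up-open {r} (0<r , x<rr) with U-open x x<rr
  ... | s , s<rr , x<s with s <? 0ℚ
  ...   | yes s<0 = let (m , 0<m , m<r) = <-dense 0<r
                    in m , m<r , 0<m , U-up x (<-trans s<0 (*-pos 0<m 0<m)) x<s
  ...   | no  s≮0 = r′ , r′<r , 0<r′ , U-up x s<r′r′ x<s
    where
    0≤s = ≮⇒≥ s≮0
    open Step r s (<⇒≤ 0<r) 0≤s using (down) renaming (r to r′)
    r′<r = proj₁ (down s<rr)
    s<r′r′ = proj₁ (proj₂ (down s<rr))
    0<r′ : 0ℚ < r′
    0<r′ = sq-cancel-< (proj₂ (proj₂ (down s<rr)))
             (subst (_< r′ * r′) (sym (*-zeroˡ 0ℚ)) (≤-<-trans 0≤s s<r′r′))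

  loc : ∀ {q r} → q < r → Lo q ⊎ Up r
  loc {q} {r} q<r with q <? 0ℚ
  ... | yes q<0 = inj₁ (inj₁ q<0)
  ... | no  q≮0 with located x (sq-mono-< (≮⇒≥ q≮0) q<r)
  ...   | inj₁ qq<x = inj₁ (inj₂ qq<x)
  ...   | inj₂ x<rr = inj₂ (≤-<-trans (≮⇒≥ q≮0) q<r , x<rr)

IsFloor : ℝ → ℤ → Set
IsFloor x m = fromℤ m ≤ᴿ x × x <ᴿ fromℤ (m ℤ.+ ℤ.1ℤ)

private
  /1-≃ : ∀ i → toℚᵘ (i / 1) ℚᵘ.≃ ℚᵘ.mkℚᵘ i 0
  /1-≃ i = toℚᵘ-fromℚᵘ (ℚᵘ.mkℚᵘ i 0)

/1-mono-< : ∀ {i j} → i ℤ.< j → i / 1 < j / 1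
/1-mono-< {i} {j} i<j = toℚᵘ-cancel-<
  (ℚᵘ.<-respˡ-≃ (ℚᵘ.≃-sym (/1-≃ i)) (ℚᵘ.<-respʳ-≃ (ℚᵘ.≃-sym (/1-≃ j))
    (ℚᵘ.*<* (subst₂ ℤ._<_ (sym (ℤ.*-identityʳ i)) (sym (ℤ.*-identityʳ j)) i<j))))

/1-cancel-< : ∀ {i j} → i / 1 < j / 1 → i ℤ.< j
/1-cancel-< {i} {j} p<q
  with ℚᵘ.<-respˡ-≃ (/1-≃ i) (ℚᵘ.<-respʳ-≃ (/1-≃ j) (toℚᵘ-mono-< p<q))
... | ℚᵘ.*<* h = subst₂ ℤ._<_ (ℤ.*-identityʳ i) (ℤ.*-identityʳ j) h

/1-mono-≤ : ∀ {i j} → i ℤ.≤ j → i / 1 ≤ j / 1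
/1-mono-≤ {i} {j} i≤j = ≮⇒≥ (λ q<p → ℤ.≤⇒≯ i≤j (/1-cancel-< q<p))

/1-* : ∀ i j → (i / 1) * (j / 1) ≡ (i ℤ.* j) / 1
/1-* i j = toℚᵘ-injective
  (ℚᵘ.≃-trans (toℚᵘ-homo-* (i / 1) (j / 1))
    (ℚᵘ.≃-trans (ℚᵘ.*-cong (/1-≃ i) (/1-≃ j)) (ℚᵘ.≃-sym (/1-≃ (i ℤ.* j)))))

IsFloor-unique : ∀ x {m m′} → IsFloor x m → IsFloor x m′ → m ≡ m′
IsFloor-unique x f g = ℤ.≤-antisym (le f g) (le g f)
  where
  le : ∀ {m m′} → IsFloor x m → IsFloor x m′ → m ℤ.≤ m′
  le {m} {m′} (m≤x , _) (_ , q , x<q , q<m′+1) =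
    subst₂ ℤ._≤_ (ℤ.pred-suc m) (trans (cong ℤ.pred (ℤ.+-comm m′ ℤ.1ℤ)) (ℤ.pred-suc m′))
      (ℤ.+-monoʳ-≤ ℤ.-1ℤ (ℤ.i<j⇒suc[i]≤j m<m′+1))
    where
    m<m′+1 : m ℤ.< m′ ℤ.+ ℤ.1ℤ
    m<m′+1 = /1-cancel-< (≤-<-trans (≮⇒≥ (λ q<m → disjoint x (m≤x q<m) x<q)) q<m′+1)

isqrt : ∀ k → ∃[ m ] m ℕ.* m ℕ.≤ k × k ℕ.< suc m ℕ.* suc m
isqrt zero = 0 , ℕ.z≤n , ℕ.s≤s ℕ.z≤n
isqrt (suc k) with isqrt k
... | m , mm≤k , k<nn with suc m ℕ.* suc m ℕ.≤? suc k
...   | yes nn≤1+k = suc m , nn≤1+k ,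
          ℕ.≤-<-trans k<nn (ℕ.*-mono-< (ℕ.n<1+n (suc m)) (ℕ.n<1+n (suc m)))
...   | no  nn≰1+k = m , ℕ.m≤n⇒m≤1+n mm≤k , ℕ.≰⇒> nn≰1+k

isFloor-√ : ∀ k m → m ℕ.* m ℕ.≤ k → k ℕ.< suc m ℕ.* suc m → IsFloor (√ (fromℕ k)) (+ m)
isFloor-√ k m mm≤k k<nn = lower , r , x<r , r<m+1
  where
  lower : fromℤ (+ m) ≤ᴿ √ (fromℕ k)
  lower {q} q<m with q <? 0ℚ
  ... | yes q<0 = inj₁ q<0
  ... | no  q≮0 = inj₂ (<-≤-trans (sq-mono-< (≮⇒≥ q≮0) q<m)
          (subst (_≤ + k / 1) (sym (trans (/1-* (+ m) (+ m)) (cong (_/ 1) (sym (ℤ.pos-* m m)))))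
            (/1-mono-≤ (ℤ.+≤+ mm≤k))))

  m+1 : ℚ
  m+1 = (+ m ℤ.+ ℤ.1ℤ) / 1

  eq : + m ℤ.+ ℤ.1ℤ ≡ + suc m
  eq = cong +_ (ℕ.+-comm m 1)

  x<m+1 : U (√ (fromℕ k)) m+1
  x<m+1 = subst (λ i → U (√ (fromℕ k)) (i / 1)) (sym eq)
    ( /1-mono-< {+ 0} {+ suc m} (ℤ.+<+ (ℕ.s≤s ℕ.z≤n))
    , subst (+ k / 1 <_) (sym (trans (/1-* (+ suc m) (+ suc m)) (cong (_/ 1) (sym (ℤ.pos-* (suc m) (suc m))))))
        (/1-mono-< (ℤ.+<+ k<nn)))

  op = U-open (√ (fromℕ k)) x<m+1
  r = proj₁ op
  r<m+1 = proj₁ (proj₂ op)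
  x<r = proj₂ (proj₂ op)

floor-√ : ∀ k → ∃ (IsFloor (√ (fromℕ k)))
floor-√ k = let (m , mm≤k , k<nn) = isqrt k in + m , isFloor-√ k m mm≤k k<nn

-- The integer part of an arbitrary Dedekind real is not computable, so ⌊_⌋ is
-- given here only on the reals √ k; IsFloor-unique makes it independent of isqrt.

⌊√_⌋ : ℕ → ℤ
⌊√ k ⌋ = proj₁ (floor-√ k)

∑[1⋯_] : ℕ → (ℕ → ℤ) → ℤ
∑[1⋯ zero ]  f = ℤ.0ℤ
∑[1⋯ suc n ] f = ∑[1⋯ n ] f ℤ.+ f (suc n)

{-# OPTIONS --safe #-}
-- ⌊√(jn)⌋ counts the k ∈ {1,…,n} with k² ≤ jn.  Exchanging the two summations,
-- k contributes the alternating sum of (−1)^(j+1) over the j ≤ n with k² ≤ jn, that is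
-- over a k < j ≤ n where a k = ⌊(k² − 1)/n⌋, so twice its contribution is (−1)^(a k) − (−1)^n.
-- Since a (n − k) + 2k = n + a k and n is odd, the signs of a k and a (n − k) are
-- opposite and cancel for k < n, which leaves k = n, where a n = n − 1 is even.
module Submission where

open import Defs
open import Data.Integer using (ℤ; +_; -1ℤ; _*_; _^_)
open import Data.Nat as ℕ using (ℕ; _+_; _/_; _≥_)
open import Data.Nat.Divisibility using (_∣_)
open import Relation.Binary.PropositionalEquality using (_≡_)
open import Relation.Nullary using (¬_)
open import Data.Bool using (if_then_else_)
import Data.Integer as ℤ
import Data.Integer.Properties as ℤ
import Data.Integer.Solver as ℤ-Solver
open import Data.Nat using (zero; suc; pred; _%_; _∸_; _⊓_; _⊔_; _≤_; _<_; _≤?_; _<?_; NonZero; z≤n; s≤s)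
open import Data.Nat.DivMod
open import Data.Nat.Divisibility using (n∣m*n; m%n≡0⇒n∣m)
import Data.Nat.Properties as ℕ
import Data.Nat.Solver as ℕ-Solver
open import Data.Product using (∃-syntax; _,_; proj₁; proj₂)
open import Function using (_⇔_; mk⇔; _∘_)
open import Relation.Binary.PropositionalEquality using (refl; sym; trans; cong; cong₂; subst; module ≡-Reasoning)
open import Relation.Nullary using (Dec; does; yes; no)
open import Relation.Nullary.Decidable using (does-⇔; dec-true; dec-false)

-- Finite sums: linearity, exchange of order and reversal.

∑-cong : ∀ n {f g} → (∀ j → 1 ≤ j → j ≤ n → f j ≡ g j) → ∑[1⋯ n ] f ≡ ∑[1⋯ n ] g
∑-cong zero    f≗g = refl
∑-cong (suc n) f≗g = cong₂ ℤ._+_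
  (∑-cong n (λ j 1≤j j≤n → f≗g j 1≤j (ℕ.m≤n⇒m≤1+n j≤n)))
  (f≗g (suc n) (s≤s z≤n) ℕ.≤-refl)

∑-+ : ∀ n f g → ∑[1⋯ n ] (λ j → f j ℤ.+ g j) ≡ ∑[1⋯ n ] f ℤ.+ ∑[1⋯ n ] g
∑-+ zero    f g = refl
∑-+ (suc n) f g = trans (cong (ℤ._+ (f (suc n) ℤ.+ g (suc n))) (∑-+ n f g))
  (solve 4 (λ a b c d → a :+ b :+ (c :+ d) := a :+ c :+ (b :+ d)) refl
    (∑[1⋯ n ] f) (∑[1⋯ n ] g) (f (suc n)) (g (suc n)))
  where open ℤ-Solver.+-*-Solver

∑-*ˡ : ∀ n c f → c * ∑[1⋯ n ] f ≡ ∑[1⋯ n ] (λ j → c * f j)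
∑-*ˡ zero    c f = ℤ.*-zeroʳ c
∑-*ˡ (suc n) c f = trans (ℤ.*-distribˡ-+ c (∑[1⋯ n ] f) (f (suc n)))
  (cong (ℤ._+ c * f (suc n)) (∑-*ˡ n c f))

∑-0 : ∀ n → ∑[1⋯ n ] (λ _ → ℤ.0ℤ) ≡ ℤ.0ℤ
∑-0 zero    = refl
∑-0 (suc n) = cong (ℤ._+ ℤ.0ℤ) (∑-0 n)

∑-1 : ∀ n → ∑[1⋯ n ] (λ _ → ℤ.1ℤ) ≡ + n
∑-1 zero    = refl
∑-1 (suc n) = trans (cong (ℤ._+ ℤ.1ℤ) (∑-1 n)) (cong +_ (ℕ.+-comm n 1))

∑-swap : ∀ m n (f : ℕ → ℕ → ℤ) →
  ∑[1⋯ m ] (λ i → ∑[1⋯ n ] (f i)) ≡ ∑[1⋯ n ] (λ j → ∑[1⋯ m ] (λ i → f i j))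
∑-swap zero    n f = sym (∑-0 n)
∑-swap (suc m) n f = trans (cong (ℤ._+ ∑[1⋯ n ] (f (suc m))) (∑-swap m n f))
  (sym (∑-+ n (λ j → ∑[1⋯ m ] (λ i → f i j)) (f (suc m))))

∑-head : ∀ n f → ∑[1⋯ suc n ] f ≡ f 1 ℤ.+ ∑[1⋯ n ] (f ∘ suc)
∑-head zero    f = ℤ.+-comm ℤ.0ℤ (f 1)
∑-head (suc n) f = trans (cong (ℤ._+ f (suc (suc n))) (∑-head n f))
  (ℤ.+-assoc (f 1) (∑[1⋯ n ] (f ∘ suc)) (f (suc (suc n))))

∑-reverse : ∀ n f → ∑[1⋯ n ] f ≡ ∑[1⋯ n ] (λ j → f (suc n ∸ j))
∑-reverse zero    f = refl
∑-reverse (suc n) f = begin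
  ∑[1⋯ n ] f ℤ.+ f (suc n)                           ≡⟨ ℤ.+-comm (∑[1⋯ n ] f) (f (suc n)) ⟩
  f (suc n) ℤ.+ ∑[1⋯ n ] f                           ≡⟨ cong (λ s → f (suc n) ℤ.+ s) (∑-reverse n f) ⟩
  -- `suc (suc n) ∸ suc j` computes to `suc n ∸ j`, so splitting off the first term leaves the
  -- shorter reversed sum.
  f (suc n) ℤ.+ ∑[1⋯ n ] (λ j → f (suc n ∸ j))       ≡⟨ ∑-head n (λ j → f (suc (suc n) ∸ j)) ⟨
  ∑[1⋯ suc n ] (λ j → f (suc (suc n) ∸ j))           ∎
  where open ≡-Reasoning

-- The sum plus its own reversal vanishes term by term, and 2 cancels in ℤ. Doubling avoids a case
-- distinction on a middle term.
∑-antisymmetric : ∀ n f → (∀ j → 1 ≤ j → j ≤ n → f j ℤ.+ f (suc n ∸ j) ≡ ℤ.0ℤ) →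
  ∑[1⋯ n ] f ≡ ℤ.0ℤ
∑-antisymmetric n f anti = ℤ.*-cancelˡ-≡ (+ 2) (∑[1⋯ n ] f) ℤ.0ℤ (begin
  + 2 * ∑[1⋯ n ] f                                   ≡⟨ solve 1 (λ x → con (+ 2) :* x := x :+ x) refl (∑[1⋯ n ] f) ⟩
  ∑[1⋯ n ] f ℤ.+ ∑[1⋯ n ] f                          ≡⟨ cong (λ s → ∑[1⋯ n ] f ℤ.+ s) (∑-reverse n f) ⟩
  ∑[1⋯ n ] f ℤ.+ ∑[1⋯ n ] (λ j → f (suc n ∸ j))      ≡⟨ ∑-+ n f (λ j → f (suc n ∸ j)) ⟨
  ∑[1⋯ n ] (λ j → f j ℤ.+ f (suc n ∸ j))             ≡⟨ ∑-cong n anti ⟩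
  ∑[1⋯ n ] (λ _ → ℤ.0ℤ)                              ≡⟨ ∑-0 n ⟩
  ℤ.0ℤ                                               ∎)
  where
  open ≡-Reasoning
  open ℤ-Solver.+-*-Solver

-- Integer square roots as counts of squares.

-- The Iverson bracket. It depends only on the Boolean `does P?`, so equivalent propositions receive
-- equal values.
⟦_⟧ : ∀ {P : Set} → Dec P → ℤ
⟦ P? ⟧ = if does P? then ℤ.1ℤ else ℤ.0ℤ

module _ {P : Set} (P? : Dec P) where

  ⟦⟧-true : P → ⟦ P? ⟧ ≡ ℤ.1ℤ
  ⟦⟧-true p = cong (if_then ℤ.1ℤ else ℤ.0ℤ) (dec-true P? p)

  ⟦⟧-false : ¬ P → ⟦ P? ⟧ ≡ ℤ.0ℤ
  ⟦⟧-false ¬p = cong (if_then ℤ.1ℤ else ℤ.0ℤ) (dec-false P? ¬p)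

  ⟦⟧-⇔ : ∀ {Q : Set} (Q? : Dec Q) → P ⇔ Q → ⟦ P? ⟧ ≡ ⟦ Q? ⟧
  ⟦⟧-⇔ Q? P⇔Q = cong (if_then ℤ.1ℤ else ℤ.0ℤ) (does-⇔ P⇔Q P? Q?)

∑-≤-indicator : ∀ n s → ∑[1⋯ n ] (λ k → ⟦ k ≤? s ⟧) ≡ + (n ⊓ s)
∑-≤-indicator zero    s = refl
∑-≤-indicator (suc n) s with suc n ≤? s
... | yes n<s = begin
  ∑[1⋯ n ] (λ k → ⟦ k ≤? s ⟧) ℤ.+ ⟦ suc n ≤? s ⟧  ≡⟨ cong₂ ℤ._+_ (∑-≤-indicator n s) (⟦⟧-true (suc n ≤? s) n<s) ⟩
  + (n ⊓ s + 1)                                   ≡⟨ cong (λ i → + (i + 1)) (ℕ.m≤n⇒m⊓n≡m (ℕ.<⇒≤ n<s)) ⟩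
  + (n + 1)                                       ≡⟨ cong +_ (ℕ.+-comm n 1) ⟩
  + suc n                                         ≡⟨ cong +_ (ℕ.m≤n⇒m⊓n≡m n<s) ⟨
  + (suc n ⊓ s)                                   ∎
  where open ≡-Reasoning
... | no n≮s = begin
  ∑[1⋯ n ] (λ k → ⟦ k ≤? s ⟧) ℤ.+ ⟦ suc n ≤? s ⟧  ≡⟨ cong₂ ℤ._+_ (∑-≤-indicator n s) (⟦⟧-false (suc n ≤? s) n≮s) ⟩
  + (n ⊓ s + 0)                                   ≡⟨ cong +_ (ℕ.+-identityʳ (n ⊓ s)) ⟩
  + (n ⊓ s)                                       ≡⟨ cong +_ (ℕ.m≥n⇒m⊓n≡n (ℕ.≮⇒≥ n≮s)) ⟩
  + s                                             ≡⟨ cong +_ (ℕ.m≥n⇒m⊓n≡n (ℕ.m≤n⇒m≤1+n (ℕ.≮⇒≥ n≮s))) ⟨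
  + (suc n ⊓ s)                                   ∎
  where open ≡-Reasoning

²-cancel-< : ∀ {m n} → m ℕ.* m < n ℕ.* n → m < n
²-cancel-< mm<nn = ℕ.≰⇒> (λ n≤m → ℕ.<⇒≱ mm<nn (ℕ.*-mono-≤ n≤m n≤m))

-- With `s` the integer square root, i² ≤ k exactly when i ≤ s. The bound k ≤ n² forces s ≤ n, so
-- counting up to `n` misses no such i.
⌊√⌋-count : ∀ n k → k ≤ n ℕ.* n → ⌊√ k ⌋ ≡ ∑[1⋯ n ] (λ i → ⟦ i ℕ.* i ≤? k ⟧)
⌊√⌋-count n k k≤nn = begin
  + s                                ≡⟨ cong +_ (ℕ.m≥n⇒m⊓n≡n s≤n) ⟨
  + (n ⊓ s)                          ≡⟨ ∑-≤-indicator n s ⟨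
  ∑[1⋯ n ] (λ i → ⟦ i ≤? s ⟧)        ≡⟨ ∑-cong n (λ i _ _ → ⟦⟧-⇔ (i ≤? s) (i ℕ.* i ≤? k) (mk⇔
                                          (λ i≤s → ℕ.≤-trans (ℕ.*-mono-≤ i≤s i≤s) ss≤k)
                                          (λ ii≤k → ℕ.≤-pred (²-cancel-< (ℕ.≤-<-trans ii≤k k<[1+s]²))))) ⟩
  ∑[1⋯ n ] (λ i → ⟦ i ℕ.* i ≤? k ⟧)  ∎
  where
  open ≡-Reasoning
  s : ℕ
  s = proj₁ (isqrt k)
  ss≤k : s ℕ.* s ≤ k
  ss≤k = proj₁ (proj₂ (isqrt k))
  k<[1+s]² : k < suc s ℕ.* suc s
  k<[1+s]² = proj₂ (proj₂ (isqrt k))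
  s≤n : s ≤ n
  s≤n = ℕ.≮⇒≥ (λ n<s → ℕ.<⇒≱ (ℕ.*-mono-< n<s n<s) (ℕ.≤-trans ss≤k k≤nn))

-- Signs and tails of the alternating sum.

ε : ℕ → ℤ
ε i = -1ℤ ^ i

ε-+ : ∀ m n → ε (m + n) ≡ ε m * ε n
ε-+ = ℤ.^-distribˡ-+-* -1ℤ

ε-even : ∀ q → ε (2 ℕ.* q) ≡ ℤ.1ℤ
ε-even q = trans (sym (ℤ.^-*-assoc -1ℤ 2 q)) (ℤ.^-zeroˡ q)

-- The maximum makes the formula hold also for b ≥ n, where the sum is empty.
∑-alternating-tail : ∀ n b →
  + 2 * ∑[1⋯ n ] (λ j → ε (j + 1) * ⟦ b <? j ⟧) ≡ ε b ℤ.- ε (n ⊔ b)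
∑-alternating-tail zero    b = sym (ℤ.+-inverseʳ (ε b))
∑-alternating-tail (suc n) b with b <? suc n
... | yes b<1+n = begin
  + 2 * (S ℤ.+ ε (suc n + 1) * ⟦ b <? suc n ⟧)
    -- The two extra signs cancel, so the new term equals `ε n`; its double turns -`ε n` into `ε n`,
    -- which is -`ε (suc n)`.
    ≡⟨ cong₂ (λ e i → + 2 * (S ℤ.+ e * i)) (ε-+ (suc n) 1) (⟦⟧-true (b <? suc n) b<1+n) ⟩
  + 2 * (S ℤ.+ (-1ℤ * ε n) * -1ℤ * ℤ.1ℤ)
    ≡⟨ solve 2 (λ s x → con (+ 2) :* (s :+ (con -1ℤ :* x) :* con -1ℤ :* con ℤ.1ℤ)
                      := con (+ 2) :* s :+ (x :+ x)) refl S (ε n) ⟩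
  + 2 * S ℤ.+ (ε n ℤ.+ ε n)
    ≡⟨ cong (ℤ._+ (ε n ℤ.+ ε n)) (∑-alternating-tail n b) ⟩
  ε b ℤ.- ε (n ⊔ b) ℤ.+ (ε n ℤ.+ ε n)
    ≡⟨ cong (λ i → ε b ℤ.- ε i ℤ.+ (ε n ℤ.+ ε n)) (ℕ.m≥n⇒m⊔n≡m (ℕ.≤-pred b<1+n)) ⟩
  ε b ℤ.- ε n ℤ.+ (ε n ℤ.+ ε n)
    ≡⟨ solve 2 (λ x y → x :- y :+ (y :+ y) := x :- con -1ℤ :* y) refl (ε b) (ε n) ⟩
  ε b ℤ.- ε (suc n)
    ≡⟨ cong (λ i → ε b ℤ.- ε i) (ℕ.m≥n⇒m⊔n≡m (ℕ.<⇒≤ b<1+n)) ⟨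
  ε b ℤ.- ε (suc n ⊔ b) ∎
  where
  open ≡-Reasoning
  open ℤ-Solver.+-*-Solver hiding (⟦_⟧)
  S : ℤ
  S = ∑[1⋯ n ] (λ j → ε (j + 1) * ⟦ b <? j ⟧)
... | no b≮1+n = begin
  + 2 * (S ℤ.+ ε (suc n + 1) * ⟦ b <? suc n ⟧)
    ≡⟨ cong (λ i → + 2 * (S ℤ.+ ε (suc n + 1) * i)) (⟦⟧-false (b <? suc n) b≮1+n) ⟩
  + 2 * (S ℤ.+ ε (suc n + 1) * ℤ.0ℤ)
    ≡⟨ solve 2 (λ s x → con (+ 2) :* (s :+ x :* con ℤ.0ℤ) := con (+ 2) :* s) refl S (ε (suc n + 1)) ⟩
  + 2 * S
    ≡⟨ ∑-alternating-tail n b ⟩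
  ε b ℤ.- ε (n ⊔ b)
    ≡⟨ cong (λ i → ε b ℤ.- ε i) (trans (ℕ.m≤n⇒m⊔n≡n (ℕ.<⇒≤ n<b)) (sym (ℕ.m≤n⇒m⊔n≡n n<b))) ⟩
  ε b ℤ.- ε (suc n ⊔ b) ∎
  where
  open ≡-Reasoning
  open ℤ-Solver.+-*-Solver hiding (⟦_⟧)
  S : ℤ
  S = ∑[1⋯ n ] (λ j → ε (j + 1) * ⟦ b <? j ⟧)
  n<b : n < b
  n<b = ℕ.≮⇒≥ b≮1+n

-- The thresholds ⌊(k² - 1)/n⌋ and their reflection.

m/n<o⇒m<o*n : ∀ {m n o} .{{_ : NonZero n}} → m / n < o → m < o ℕ.* n
m/n<o⇒m<o*n {m} {n} m/n<o = ℕ.≰⇒> λ on≤m →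
  ℕ.<⇒≱ m/n<o (subst (_≤ m / n) (m*n/n≡m _ n) (/-monoˡ-≤ n on≤m))

module _ (n : ℕ) .{{_ : NonZero n}} where

  -- The predecessor converts the weak condition k² ≤ jn into a strict one, which passes to the
  -- quotient as `a k < j`. Since `pred 0` is 0, this fails at k = j = 0.
  a : ℕ → ℕ
  a k = pred (k ℕ.* k) / n

  a<⇔ : ∀ {k} j → 1 ≤ k → k ℕ.* k ≤ j ℕ.* n ⇔ a k < j
  a<⇔ {suc _} j _ = mk⇔ (m<n*o⇒m/o<n {n = j}) m/n<o⇒m<o*n

  a<n : ∀ k → 1 ≤ k → k ≤ n → a k < n
  a<n (suc _) _ k≤n = m<n*o⇒m/o<n (ℕ.*-mono-≤ k≤n k≤n)

  -- From l = n - k comes l² + 2kn = k² + n². Subtracting 1 and dividing by `n` gives the claim,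
  -- since multiples of `n` leave the floor exactly. The additive form avoids truncated subtraction.
  a-reflect : ∀ k l → 1 ≤ k → 1 ≤ l → k + l ≡ n → a l + 2 ℕ.* k ≡ n + a k
  a-reflect k@(suc k′) l@(suc l′) _ _ k+l≡n = begin
    a l + 2 ℕ.* k                                 ≡⟨ cong (λ i → a l + i) (m*n/n≡m (2 ℕ.* k) n) ⟨
    a l + 2 ℕ.* k ℕ.* n / n                       ≡⟨ +-distrib-/-∣ʳ (pred (l ℕ.* l)) (n∣m*n (2 ℕ.* k)) ⟨
    (pred (l ℕ.* l) + 2 ℕ.* k ℕ.* n) / n          ≡⟨ /-congˡ (subst
        (λ i → pred (l ℕ.* l) + 2 ℕ.* k ℕ.* i ≡ pred (k ℕ.* k) + i ℕ.* i) k+l≡n squares) ⟩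
    (pred (k ℕ.* k) + n ℕ.* n) / n                ≡⟨ +-distrib-/-∣ʳ (pred (k ℕ.* k)) (n∣m*n n) ⟩
    a k + n ℕ.* n / n                             ≡⟨ cong (λ i → a k + i) (m*n/n≡m n n) ⟩
    a k + n                                       ≡⟨ ℕ.+-comm (a k) n ⟩
    n + a k                                       ∎
    where
    open ≡-Reasoning
    open ℕ-Solver.+-*-Solver
    squares : pred (l ℕ.* l) + 2 ℕ.* k ℕ.* (k + l) ≡ pred (k ℕ.* k) + (k + l) ℕ.* (k + l)
    squares = solve 2 (λ x y →
      let x⁺ = con 1 :+ x ; y⁺ = con 1 :+ y in
      -- `pred (suc y * suc y)` computes to `y + y * suc y`, which is a polynomial without
      -- predecessor.
      y :+ y :* y⁺ :+ con 2 :* x⁺ :* (x⁺ :+ y⁺) := x :+ x :* x⁺ :+ (x⁺ :+ y⁺) :* (x⁺ :+ y⁺))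
      refl k′ l′

  -- The factor 2 keeps the closed form of each tail free of division.
  ∑-⌊√⌋ : + 2 * ∑[1⋯ n ] (λ j → ε (j + 1) * ⌊√ (j ℕ.* n) ⌋)
        ≡ ∑[1⋯ n ] (λ k → ε (a k) ℤ.- ε n)
  ∑-⌊√⌋ = begin
    + 2 * ∑[1⋯ n ] (λ j → ε (j + 1) * ⌊√ (j ℕ.* n) ⌋)
      ≡⟨ cong (+ 2 *_) (∑-cong n (λ j _ j≤n → trans
           (cong (ε (j + 1) *_) (⌊√⌋-count n (j ℕ.* n) (ℕ.*-monoˡ-≤ n j≤n)))
           (∑-*ˡ n (ε (j + 1)) (λ k → ⟦ k ℕ.* k ≤? j ℕ.* n ⟧)))) ⟩
    + 2 * ∑[1⋯ n ] (λ j → ∑[1⋯ n ] (λ k → ε (j + 1) * ⟦ k ℕ.* k ≤? j ℕ.* n ⟧))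
      ≡⟨ cong (+ 2 *_) (∑-swap n n (λ j k → ε (j + 1) * ⟦ k ℕ.* k ≤? j ℕ.* n ⟧)) ⟩
    + 2 * ∑[1⋯ n ] (λ k → ∑[1⋯ n ] (λ j → ε (j + 1) * ⟦ k ℕ.* k ≤? j ℕ.* n ⟧))
      ≡⟨ ∑-*ˡ n (+ 2) (λ k → ∑[1⋯ n ] (λ j → ε (j + 1) * ⟦ k ℕ.* k ≤? j ℕ.* n ⟧)) ⟩
    ∑[1⋯ n ] (λ k → + 2 * ∑[1⋯ n ] (λ j → ε (j + 1) * ⟦ k ℕ.* k ≤? j ℕ.* n ⟧))
      ≡⟨ ∑-cong n contribution ⟩
    ∑[1⋯ n ] (λ k → ε (a k) ℤ.- ε n) ∎
    where
    open ≡-Reasoning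
    contribution : ∀ k → 1 ≤ k → k ≤ n →
      + 2 * ∑[1⋯ n ] (λ j → ε (j + 1) * ⟦ k ℕ.* k ≤? j ℕ.* n ⟧) ≡ ε (a k) ℤ.- ε n
    contribution k 1≤k k≤n = begin
      + 2 * ∑[1⋯ n ] (λ j → ε (j + 1) * ⟦ k ℕ.* k ≤? j ℕ.* n ⟧)
        ≡⟨ cong (+ 2 *_) (∑-cong n (λ j _ _ → cong (ε (j + 1) *_)
             (⟦⟧-⇔ (k ℕ.* k ≤? j ℕ.* n) (a k <? j) (a<⇔ j 1≤k)))) ⟩
      + 2 * ∑[1⋯ n ] (λ j → ε (j + 1) * ⟦ a k <? j ⟧)
        ≡⟨ ∑-alternating-tail n (a k) ⟩
      ε (a k) ℤ.- ε (n ⊔ a k)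
        ≡⟨ cong (λ i → ε (a k) ℤ.- ε i) (ℕ.m≥n⇒m⊔n≡m (ℕ.<⇒≤ (a<n k 1≤k k≤n))) ⟩
      ε (a k) ℤ.- ε n ∎

-- Cancellation of signs for n = 2q + 1.

module _ (q : ℕ) where
  private
    m n : ℕ
    m = 2 ℕ.* q
    n = suc m

  ε-odd : ε n ≡ -1ℤ
  ε-odd = cong (-1ℤ *_) (ε-even q)

  ε-a-cancel : ∀ k → 1 ≤ k → k ≤ m → ε (a n k) ℤ.+ ε (a n (n ∸ k)) ≡ ℤ.0ℤ
  ε-a-cancel k 1≤k k≤m = begin
    -- The factor 1 is written as `ε (2k)` to bring in the left side of `a-reflect`.
    ε (a n k) ℤ.+ ε (a n l)                     ≡⟨ cong (λ s → ε (a n k) ℤ.+ s) (ℤ.*-identityʳ (ε (a n l))) ⟨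
    ε (a n k) ℤ.+ ε (a n l) * ℤ.1ℤ              ≡⟨ cong (λ e → ε (a n k) ℤ.+ ε (a n l) * e) (ε-even k) ⟨
    ε (a n k) ℤ.+ ε (a n l) * ε (2 ℕ.* k)       ≡⟨ cong (λ s → ε (a n k) ℤ.+ s) (ε-+ (a n l) (2 ℕ.* k)) ⟨
    ε (a n k) ℤ.+ ε (a n l + 2 ℕ.* k)           ≡⟨ cong (λ i → ε (a n k) ℤ.+ ε i)
                                                     (a-reflect n k l 1≤k (ℕ.m<n⇒0<n∸m (s≤s k≤m))
                                                       (ℕ.m+[n∸m]≡n (ℕ.m≤n⇒m≤1+n k≤m))) ⟩
    ε (a n k) ℤ.+ ε (n + a n k)                 ≡⟨ cong (λ s → ε (a n k) ℤ.+ s) (ε-+ n (a n k)) ⟩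
    ε (a n k) ℤ.+ ε n * ε (a n k)               ≡⟨ cong (λ e → ε (a n k) ℤ.+ e * ε (a n k)) ε-odd ⟩
    ε (a n k) ℤ.+ -1ℤ * ε (a n k)               ≡⟨ solve 1 (λ x → x :+ con -1ℤ :* x := con ℤ.0ℤ) refl (ε (a n k)) ⟩
    ℤ.0ℤ                                        ∎
    where
    open ≡-Reasoning
    open ℤ-Solver.+-*-Solver
    l : ℕ
    l = n ∸ k

  -- Here n² - 1 = m + mn with m < n, so the quotient by `n` is `m`.
  a-last : a n n ≡ m
  a-last = ℕ.≤-antisym (ℕ.≤-pred (a<n n n (s≤s z≤n) ℕ.≤-refl))
    (subst (_≤ a n n) (m*n/n≡m m n) (/-monoˡ-≤ n (ℕ.m≤n+m (m ℕ.* n) m)))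

  -- The first `m` terms cancel under k ↦ n - k; the last term has the even exponent `m` = 2q.
  ∑-ε-a : ∑[1⋯ n ] (λ k → ε (a n k)) ≡ ℤ.1ℤ
  ∑-ε-a = cong₂ ℤ._+_ (∑-antisymmetric m (λ k → ε (a n k)) ε-a-cancel)
    (trans (cong ε a-last) (ε-even q))

  alternating-⌊√⌋ : ∑[1⋯ n ] (λ j → ε (j + 1) * ⌊√ (j ℕ.* n) ⌋) ≡ + suc q
  alternating-⌊√⌋ = ℤ.*-cancelˡ-≡ (+ 2) _ _ (begin
    + 2 * ∑[1⋯ n ] (λ j → ε (j + 1) * ⌊√ (j ℕ.* n) ⌋)     ≡⟨ ∑-⌊√⌋ n ⟩
    ∑[1⋯ n ] (λ k → ε (a n k) ℤ.- ε n)                    ≡⟨ ∑-cong n (λ k _ _ → cong (λ e → ε (a n k) ℤ.- e) ε-odd) ⟩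
    -- Subtracting `ε n` = -1 adds 1 to each of the `n` terms, so the total becomes 1 + n = 2(q +
    -- 1).
    ∑[1⋯ n ] (λ k → ε (a n k) ℤ.+ ℤ.1ℤ)                   ≡⟨ ∑-+ n (λ k → ε (a n k)) (λ _ → ℤ.1ℤ) ⟩
    ∑[1⋯ n ] (λ k → ε (a n k)) ℤ.+ ∑[1⋯ n ] (λ _ → ℤ.1ℤ)  ≡⟨ cong₂ ℤ._+_ ∑-ε-a (∑-1 n) ⟩
    + suc n                                               ≡⟨ cong +_ (ℕ.*-suc 2 q) ⟨
    + (2 ℕ.* suc q)                                       ≡⟨ ℤ.pos-* 2 (suc q) ⟩
    + 2 * + suc q                                         ∎)
    where open ≡-Reasoning

-- The remainder modulo 2 is below 2 and, since 2 does not divide `n`, nonzero; hence it is 1.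
odd⇒1+2q : ∀ n → ¬ (2 ∣ n) → ∃[ q ] n ≡ suc (2 ℕ.* q)
odd⇒1+2q n 2∤n = n / 2 , trans (m≡m%n+[m/n]*n n 2)
  (cong₂ _+_ n%2≡1 (ℕ.*-comm (n / 2) 2))
  where
  n%2≡1 : n % 2 ≡ 1
  n%2≡1 = ℕ.≤-antisym (ℕ.≤-pred (m%n<n n 2)) (ℕ.n≢0⇒n>0 (2∤n ∘ m%n≡0⇒n∣m n 2))

theorem1p1 : (n : ℕ) → n ≥ 1 → ¬ (2 ∣ n) →
    ∑[1⋯ n ] (λ j → (-1ℤ ^ (j + 1)) * ⌊√ (j ℕ.* n) ⌋) ≡ + ((n + 1) / 2)
theorem1p1 n _ 2∤n with odd⇒1+2q n 2∤n
... | q , refl = trans (alternating-⌊√⌋ q) (cong +_ (sym (begin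
  (suc (2 ℕ.* q) + 1) / 2  ≡⟨ /-congˡ {o = 2} (solve 1 (λ x → con 1 :+ con 2 :* x :+ con 1 := (con 1 :+ x) :* con 2) refl q) ⟩
  suc q ℕ.* 2 / 2          ≡⟨ m*n/n≡m (suc q) 2 ⟩
  suc q                    ∎)))
  where
  open ≡-Reasoning
  open ℕ-Solver.+-*-Solver
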